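{- Let $G$ and $H$ be graphs. Then $$\gamma_{cg}'(G[H]) = \begin{cases} \gamma_{cg}'(G); & \gamma_{cg}'(G) \geq 2,\\ 2; & \gamma_{cg}'(G) = 1,\ |V(G)| \geq 2 \text{ and } \gamma_{cg}'(H) \geq 2,\\ \gamma_{cg}'(H); & |V(G)| = 1, \text{ or } \big(\gamma_{cg}'(G) = 1,\ |V(G)| \geq 2 \text{ and } \gamma_{cg}'(H) = 1\big). \end{cases}$$
   Context: The connected domination game on a graph $G$ is played by two players, Dominator and Staller, who alternately select vertices. Each selected vertex must dominate at least one vertex not dominated by the previous moves (a vertex $w$ dominates the vertices of its closed neighborhood $N[w]$), and, except for the first move, it must be adjacent to at least one already selected vertex. The game ends when no more moves are possible, i.e. when the selected vertices form a connected dominating set. Dominator's goal is to finish the game with the smallest possible number of moves, while Staller aims to prolong the game. $\gamma_{cg}'(G)$ (the Staller-start connected game domination number) is the number of moves in the game on $G$ when Staller makes the first move and both players play optimally. The lexicographic product $G[H]$ has vertex set $V(G)\times V(H)$, with $(g_1,h_1)$ adjacent to $(g_2,h_2)$ if $g_1g_2\in E(G)$, or $g_1=g_2$ and $h_1h_2\in E(H)$. -}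

module Defs where

open import Data.Fin using (Fin)
open import Data.Fin.Properties using (*↔×; any?; inj⇒≟)
open import Data.List using (List; []; _∷_; map; filter; allFin)
open import Data.List.Extrema.Nat using (min; max)
open import Data.List.Relation.Unary.Any as Any using (Any)
open import Data.Nat using (ℕ; zero; suc; _*_; NonZero)
open import Data.Nat.Properties using (m*n≢0)
open import Data.Product using (_×_; _,_; ∃)
open import Data.Product.Function.NonDependent.Propositional using (_×-↔_)
open import Data.Sum using (_⊎_; inj₁; inj₂)
open import Function using (_∘_)
open import Function.Bundles using (_↔_; Inverse)
open import Function.Construct.Composition using (_↔-∘_)
open import Function.Construct.Symmetry using (↔-sym)
open import Function.Properties.Inverse using (↔⇒↣)
open import Relation.Binary using (Rel; Decidable; DecidableEquality; Symmetric; Irreflexive)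
open import Relation.Binary.Construct.Closure.ReflexiveTransitive using (Star)
open import Relation.Binary.PropositionalEquality using (_≡_; refl; sym; subst)
open import Relation.Nullary using (¬_; Dec; yes; no)
open import Relation.Nullary.Decidable using (map′; ¬?; _×-dec_; _⊎-dec_)
open import Relation.Unary as Unary using (Pred)
open import Level using (0ℓ)

-- Finite simple graphs.  As usual, the vertex set is nonempty.
record Graph : Set₁ where
  field
    V          : Set
    order      : ℕ
    finite     : V ↔ Fin order
    nonempty   : NonZero order
    Adj        : Rel V 0ℓ
    adj?       : Decidable Adj
    adj-sym    : Symmetric Adj
    adj-irrefl : Irreflexive _≡_ Adj

  _≟_ : DecidableEquality V
  _≟_ = inj⇒≟ (↔⇒↣ finite)

  vertices : List V
  vertices = map (Inverse.from finite) (allFin order)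

  ∃? : {P : Pred V 0ℓ} → Unary.Decidable P → Dec (∃ P)
  ∃? {P} P? = map′
    (λ (i , p) → Inverse.from finite i , p)
    (λ (v , p) → Inverse.to finite v
               , subst P (sym (Inverse.strictlyInverseʳ finite v)) p)
    (any? (P? ∘ Inverse.from finite))

open Graph using (order) public

Connected : Graph → Set
Connected G = ∀ u v → Star Adj u v
  where open Graph G

data Player : Set where
  dominator staller : Player

opponent : Player → Player
opponent dominator = staller
opponent staller   = dominator

-- The number of remaining moves for the player to move, given the list of the
-- numbers of moves that would follow each of the available moves.  The game
-- is over when no move is available.
optimum : Player → List ℕ → ℕ
optimum _         []       = 0
optimum dominator (n ∷ ns) = suc (min n ns)
optimum staller   (n ∷ ns) = suc (max n ns)

module Game (G : Graph) where
  open Graph G hiding (order)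

  infix 4 _∈N[_]

  _∈N[_] : V → V → Set
  w ∈N[ v ] = w ≡ v ⊎ Adj v w

  _∈N[_]? : Decidable _∈N[_]
  w ∈N[ v ]? = (w ≟ v) ⊎-dec adj? v w

  -- A position is the list of the vertices selected so far, latest first.
  Position : Set
  Position = List V

  Dominated : Position → Pred V 0ℓ
  Dominated S w = Any (w ∈N[_]) S

  dominated? : ∀ S → Unary.Decidable (Dominated S)
  dominated? S w = Any.any? (w ∈N[_]?) S

  -- The first move is only required to dominate a new vertex.
  Attached : Position → Pred V 0ℓ
  Attached S v = S ≡ [] ⊎ Any (Adj v) S

  attached? : ∀ S → Unary.Decidable (Attached S)
  attached? []      v = yes (inj₁ refl)
  attached? (s ∷ S) v = map′ inj₂ (λ { (inj₂ a) → a }) (Any.any? (adj? v) (s ∷ S))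

  Legal : Position → Pred V 0ℓ
  Legal S v = Attached S v × ∃ λ w → w ∈N[ v ] × ¬ Dominated S w

  legal? : ∀ S → Unary.Decidable (Legal S)
  legal? S v = attached? S v ×-dec ∃? (λ w → (w ∈N[ v ]?) ×-dec ¬? (dominated? S w))

  legalMoves : Position → List V
  legalMoves S = filter (legal? S) vertices

  -- The number of moves made from S on, with player p to move and both playing
  -- optimally, when the play is cut off after k further moves.
  movesWithin : ℕ → Player → Position → ℕ
  movesWithin zero    p S = 0
  movesWithin (suc k) p S =
    optimum p (map (λ v → movesWithin k (opponent p) (v ∷ S)) (legalMoves S))

-- Every legal move dominates a new vertex, so a play has at most `order G`
-- moves and the cut-off is never felt.  On a connected graph a play ends
-- exactly when the selected vertices form a connected dominating set; on a
-- disconnected one the game is not considered, and the value is meaningless.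
γcg′ : Graph → ℕ
γcg′ G = Game.movesWithin G (order G) staller []

infix 8 _[_]

-- The lexicographic product.
_[_] : Graph → Graph → Graph
G [ H ] = record
  { V          = G.V × H.V
  ; order      = G.order * H.order
  ; finite     = ↔-sym *↔× ↔-∘ (G.finite ×-↔ H.finite)
  ; nonempty   = m*n≢0 G.order H.order {{G.nonempty}} {{H.nonempty}}
  ; Adj        = λ (g₁ , h₁) (g₂ , h₂) → G.Adj g₁ g₂ ⊎ (g₁ ≡ g₂ × H.Adj h₁ h₂)
  ; adj?       = λ (g₁ , h₁) (g₂ , h₂) →
                   G.adj? g₁ g₂ ⊎-dec ((g₁ G.≟ g₂) ×-dec H.adj? h₁ h₂)
  ; adj-sym    = λ { (inj₁ a)       → inj₁ (G.adj-sym a)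
                   ; (inj₂ (e , a)) → inj₂ (sym e , H.adj-sym a) }
  ; adj-irrefl = λ { refl (inj₁ a)       → G.adj-irrefl refl a
                   ; refl (inj₂ (_ , a)) → H.adj-irrefl refl a }
  }
  where
    module G = Graph G
    module H = Graph H

{-# OPTIONS --safe #-}
module Submission where

-- After the first move the play depends only on the set D of dominated
-- vertices: v may be played iff v ∈ D and N[v] ⊄ D, and then D becomes D ∪ N[v].
-- Hence replacing D by D ∪ N[v] with v ∈ D never lengthens the play (whoever is
-- to move), and skipping a turn saves Dominator at most one move.  In G [ H ],
-- once two adjacent fibres have been played in, the dominated set is a union of
-- fibres and the play is one on G.  Until then the play stays in the first fibre:
-- Dominator gains nothing by staying there, and he can always leave it.

open import Defs
open import Data.Fin using (Fin; zero; suc)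
open import Data.List using ([]; _∷_; map; filter; length; allFin)
open import Data.List.Extrema.Nat using (argmin-sel; argmax-sel; min≤⊤; min≤xs; ⊥≤max; xs≤max)
open import Data.List.Membership.Propositional using (_∈_; lose)
open import Data.List.Membership.Propositional.Properties using (∈-map⁺; ∈-map⁻; ∈-filter⁺; ∈-filter⁻; ∈-allFin)
open import Data.List.Properties using (filter-notAll; length-map; length-tabulate)
open import Data.List.Relation.Unary.All as All using (All; []; _∷_)
open import Data.List.Relation.Unary.Any as Any using (Any; here; there)
open import Data.Nat using (ℕ; zero; suc; _+_; _∸_; _⊔_; _≤_; _≥_; z≤n; s≤s; s≤s⁻¹; NonZero)
open import Data.Nat.Properties using (≤-trans; ≤-reflexive; ≤-antisym; n≤1+n; n≤0⇒n≡0; m≤n⇒m≤1+n; m+[n∸m]≡n; m≤m*n; m≤n*m; m≤m⊔n; m≤n⊔m; m≤n⇒m⊔n≡n; ⊔-monoʳ-≤; module ≤-Reasoning)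
open import Data.Product using (_×_; _,_; ∃; proj₁; proj₂)
open import Data.Sum using (_⊎_; inj₁; inj₂)
open import Function using (_∘_; id)
open import Function.Bundles using (Inverse)
open import Relation.Binary.Construct.Closure.ReflexiveTransitive using (Star; ε; _◅_)
open import Relation.Binary.PropositionalEquality using (_≡_; _≢_; refl; sym; trans; cong; subst; module ≡-Reasoning)
open import Relation.Nullary using (¬_; yes; no; contradiction)
open import Relation.Nullary.Decidable using (¬?)
open import Relation.Unary using (Pred; _≐_)

-- Optimal values as attained extrema.

optimum-attained : ∀ p ns → ns ≡ [] ⊎ (∃ λ n → n ∈ ns × optimum p ns ≡ suc n)
optimum-attained p         []       = inj₁ refl
optimum-attained dominator (n ∷ ns) with argmin-sel id n ns
... | inj₁ e = inj₂ (n , here refl , cong suc e)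
... | inj₂ i = inj₂ (_ , there i , refl)
optimum-attained staller   (n ∷ ns) with argmax-sel id n ns
... | inj₁ e = inj₂ (n , here refl , cong suc e)
... | inj₂ i = inj₂ (_ , there i , refl)

optimum-dominator-≤ : ∀ {n ns} → n ∈ ns → optimum dominator ns ≤ suc n
optimum-dominator-≤ {ns = m ∷ ns} (here refl) = s≤s (min≤⊤ m ns)
optimum-dominator-≤ {ns = m ∷ ns} (there i)   = s≤s (All.lookup (min≤xs m ns) i)

optimum-staller-≥ : ∀ {n ns} → n ∈ ns → suc n ≤ optimum staller ns
optimum-staller-≥ {ns = m ∷ ns} (here refl) = s≤s (⊥≤max m ns)
optimum-staller-≥ {ns = m ∷ ns} (there i)   = s≤s (All.lookup (xs≤max m ns) i)

-- Legal moves in terms of dominated vertices.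

module Play (G : Graph) where
  open Graph G hiding (order)
  open Game G public

  ∈-vertices : ∀ v → v ∈ vertices
  ∈-vertices v = subst (_∈ vertices) (Inverse.strictlyInverseʳ finite v)
    (∈-map⁺ (Inverse.from finite) (∈-allFin (Inverse.to finite v)))

  length-vertices : length vertices ≡ order G
  length-vertices = trans (length-map (Inverse.from finite) (allFin (order G))) (length-tabulate id)

  someVertex : V
  someVertex = go (order G) nonempty (Inverse.from finite)
    where
    go : ∀ n → NonZero n → (Fin n → V) → V
    go (suc _) _ f = f zero

  Fresh : Position → Pred V _
  Fresh S v = ∃ λ w → w ∈N[ v ] × ¬ Dominated S w

  legal-[] : ∀ v → Legal [] v
  legal-[] v = inj₁ refl , v , inj₁ refl , λ ()

  -- A dominated `v` is either a selected vertex or adjacent to one. In the former case all of its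
  -- closed neighbourhood is dominated, contrary to freshness, so `v` is attached.
  legal : ∀ {S v} → Dominated S v → Fresh S v → Legal S v
  legal d f = inj₂ (adjacent d f) , f
    where
    adjacent : ∀ {S v} → Dominated S v → Fresh S v → Any (Adj v) S
    adjacent (here (inj₁ refl)) (_ , w∈Nv , w∉S) = contradiction (here w∈Nv) w∉S
    adjacent (here (inj₂ a))    _                = here (adj-sym a)
    adjacent (there d)          (w , w∈Nv , w∉S) = there (adjacent d (w , w∈Nv , w∉S ∘ there))

  -- The dominated `u` certifies that `S` is nonempty: a first move is legal without being
  -- dominated.
  legal⇒dominated : ∀ {S u v} → Dominated S u → Legal S v → Dominated S v
  legal⇒dominated () (inj₁ refl , _)
  legal⇒dominated _  (inj₂ a , _) = Any.map (inj₂ ∘ adj-sym) a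

  ∈-legalMoves : ∀ {S v} → Legal S v → v ∈ legalMoves S
  ∈-legalMoves {S} {v} = ∈-filter⁺ (legal? S) (∈-vertices v)

  attained : ∀ k p S →
    (movesWithin (suc k) p S ≡ 0 × (∀ v → ¬ Legal S v)) ⊎
    (∃ λ v → Legal S v × movesWithin (suc k) p S ≡ suc (movesWithin k (opponent p) (v ∷ S)))
  attained k p S with optimum-attained p (map (λ v → movesWithin k (opponent p) (v ∷ S)) (legalMoves S))
  ... | inj₂ (n , n∈ , e) with ∈-map⁻ _ n∈
  ...   | v , v∈ , refl = inj₂ (v , proj₂ (∈-filter⁻ (legal? S) {xs = vertices} v∈) , e)
  attained k p S | inj₁ e = inj₁ (cong (optimum p) e , λ v l → none e (∈-map⁺ _ (∈-legalMoves l)))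
    where
    none : ∀ {n : ℕ} {ns} → ns ≡ [] → ¬ (n ∈ ns)
    none refl ()

  dominator-≤ : ∀ k {S v} → Legal S v →
    movesWithin (suc k) dominator S ≤ suc (movesWithin k staller (v ∷ S))
  dominator-≤ k l = optimum-dominator-≤ (∈-map⁺ _ (∈-legalMoves l))

  staller-≥ : ∀ k {S v} → Legal S v →
    suc (movesWithin k dominator (v ∷ S)) ≤ movesWithin (suc k) staller S
  staller-≥ k l = optimum-staller-≥ (∈-map⁺ _ (∈-legalMoves l))

  movesWithin-over : ∀ k p {S} → (∀ v → ¬ Legal S v) → movesWithin k p S ≡ 0
  movesWithin-over zero    p over = refl
  movesWithin-over (suc k) p {S} over with attained k p S
  ... | inj₁ (e , _)     = e
  ... | inj₂ (v , l , _) = contradiction l (over v)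

-- Comparing plays on two graphs.

Matched : (G H : Graph) (k l : ℕ) → Player → Game.Position G → Game.Position H → Set
Matched G H k l p S T = ∀ v → Game.Legal G S v → ∃ λ u → Game.Legal H T u ×
  Game.movesWithin G k (opponent p) (v ∷ S) ≡ Game.movesWithin H l (opponent p) (u ∷ T)

-- For Staller the best option on `G` is copied to `H`; for Dominator the best option on `H` is
-- copied to `G`. `S⇒T` also excludes that only the play on `H` is over, where its value 0 would be
-- too small. Options agree in value, without any bijection between the moves.
matched-≤ : ∀ G H k l p {S T} → Matched G H k l p S T → Matched H G l k p T S →
  Game.movesWithin G (suc k) p S ≤ Game.movesWithin H (suc l) p T
matched-≤ G H k l p {S} {T} S⇒T T⇒S with Play.attained G k p S | Play.attained H l p T
... | inj₁ (e , _) | _ = ≤-trans (≤-reflexive e) z≤n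
matched-≤ G H k l p S⇒T T⇒S | inj₂ (v , lv , _) | inj₁ (_ , over) =
  contradiction (proj₁ (proj₂ (S⇒T v lv))) (over _)
matched-≤ G H k l dominator S⇒T T⇒S | inj₂ _ | inj₂ (u , lu , e) with T⇒S u lu
... | v , lv , e′ = ≤-trans (Play.dominator-≤ G k lv) (≤-reflexive (trans (cong suc (sym e′)) (sym e)))
matched-≤ G H k l staller S⇒T T⇒S | inj₂ (v , lv , e) | inj₂ _ with S⇒T v lv
... | u , lu , e′ = ≤-trans (≤-reflexive (trans e (cong suc e′))) (Play.staller-≥ H l lu)

matched-≡ : ∀ G H k l p {S T} → Matched G H k l p S T → Matched H G l k p T S →
  Game.movesWithin G (suc k) p S ≡ Game.movesWithin H (suc l) p T
matched-≡ G H k l p S⇒T T⇒S =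
  ≤-antisym (matched-≤ G H k l p S⇒T T⇒S) (matched-≤ H G l k p T⇒S S⇒T)

-- Lifting plays along a projection of graphs.

module Projection (G′ G : Graph) (π : Graph.V G′ → Graph.V G) (σ : Graph.V G → Graph.V G′)
  (π∘σ : ∀ v → π (σ v) ≡ v)
  (adj⁺ : ∀ {u x} → Graph.Adj G (π u) (π x) → Graph.Adj G′ u x)
  (adj⁻ : ∀ {u x} → Graph.Adj G′ u x → Game._∈N[_] G (π x) (π u))
  where

  private
    module P  = Play G
    module P′ = Play G′

  ∈N-π : ∀ {u x} → x P′.∈N[ u ] → π x P.∈N[ π u ]
  ∈N-π (inj₁ refl) = inj₁ refl
  ∈N-π (inj₂ a)    = adj⁻ a

  lifted-fresh : ∀ {S T u} → P′.Dominated T ≐ P.Dominated S ∘ π → P.Fresh S (π u) → P′.Fresh T u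
  lifted-fresh {u = u} (T⊆S , _) (_ , inj₁ refl , w∉S) = u , inj₁ refl , w∉S ∘ T⊆S
  lifted-fresh (T⊆S , _) (w , inj₂ a , w∉S) with σ w | π∘σ w
  ... | x | refl = x , inj₂ (adj⁺ a) , w∉S ∘ T⊆S

  projected-fresh : ∀ {S T u} → P′.Dominated T ≐ P.Dominated S ∘ π → P′.Fresh T u → P.Fresh S (π u)
  projected-fresh (_ , S⊆T) (x , x∈Nu , x∉T) = π x , ∈N-π x∈Nu , x∉T ∘ S⊆T

  -- The preimage of the closed neighbourhood of `π u` contains the whole fibre over `π u`, which
  -- the closed neighbourhood of `u` need not. Those vertices are dominated already, because `π u`
  -- is.
  lifted-move : ∀ {S T u} → P′.Dominated T ≐ P.Dominated S ∘ π → P.Dominated S (π u) →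
    P′.Dominated (u ∷ T) ≐ P.Dominated (π u ∷ S) ∘ π
  lifted-move {S} {T} {u} (T⊆S , S⊆T) d = to , from
    where
    to : ∀ {x} → P′.Dominated (u ∷ T) x → P.Dominated (π u ∷ S) (π x)
    to (here x∈Nu) = here (∈N-π x∈Nu)
    to (there dx)  = there (T⊆S dx)

    from : ∀ {x} → P.Dominated (π u ∷ S) (π x) → P′.Dominated (u ∷ T) x
    from (here (inj₁ e)) = there (S⊆T (subst (P.Dominated S) (sym e) d))
    from (here (inj₂ a)) = here (inj₂ (adj⁺ a))
    from (there dx)      = there (S⊆T dx)

  -- Playing `u` above and `π u` below keeps the dominated set above equal to the preimage of the
  -- one below, and by the section `σ` every move below comes from one above. The positions are
  -- nonempty so that every further move is at a dominated vertex.
  lift : ∀ k p {s S t T} → P′.Dominated (t ∷ T) ≐ P.Dominated (s ∷ S) ∘ π →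
    P′.movesWithin k p (t ∷ T) ≡ P.movesWithin k p (s ∷ S)
  lift zero    p S≐T = refl
  lift (suc k) p {s} {S} {t} {T} T≐S@(T⊆S , S⊆T) = matched-≡ G′ G k k p down up
    where
    down : Matched G′ G k k p (t ∷ T) (s ∷ S)
    down u l@(_ , f) = π u , P.legal d (projected-fresh T≐S f) , lift k (opponent p) (lifted-move T≐S d)
      where
      d = T⊆S (P′.legal⇒dominated (here (inj₁ refl)) l)

    up : Matched G G′ k k p (s ∷ S) (t ∷ T)
    up v l@(_ , f) with σ v | π∘σ v
    ... | u | refl = u , P′.legal (S⊆T d) (lifted-fresh T≐S f) , sym (lift k (opponent p) (lifted-move T≐S d))
      where
      d = P.legal⇒dominated (here (inj₁ refl)) l

-- Monotonicity and skipped turns.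

module Monotonicity (G : Graph) where
  open Graph G hiding (order)
  open Play G public

  movesWithin-≐ : ∀ k p {s S t T} → Dominated (t ∷ T) ≐ Dominated (s ∷ S) →
    movesWithin k p (t ∷ T) ≡ movesWithin k p (s ∷ S)
  movesWithin-≐ = Projection.lift G G id id (λ _ → refl) id inj₂

  swap : ∀ k p u v {S} → movesWithin k p (u ∷ v ∷ S) ≡ movesWithin k p (v ∷ u ∷ S)
  swap k p u v = movesWithin-≐ k p (exchange , exchange)
    where
    exchange : ∀ {u v S w} → Dominated (u ∷ v ∷ S) w → Dominated (v ∷ u ∷ S) w
    exchange (here e)          = there (here e)
    exchange (there (here e))  = here e
    exchange (there (there d)) = there (there d)

  -- An undominated vertex in the closed neighbourhood of `v` would make `v` legal, so selecting `v`
  -- dominates nothing new.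
  absorb : ∀ k p {S v} → Dominated S v → ¬ Legal S v → movesWithin k p (v ∷ S) ≡ movesWithin k p S
  absorb k p {s ∷ S} {v} d ¬l = movesWithin-≐ k p (to , there)
    where
    to : ∀ {w} → Dominated (v ∷ s ∷ S) w → Dominated (s ∷ S) w
    to (there dw) = dw
    to {w} (here w∈Nv) with dominated? (s ∷ S) w
    ... | yes dw = dw
    ... | no ¬dw = contradiction (legal d (w , w∈Nv , ¬dw)) ¬l

  -- Proved together with `dominator-≤-any` by induction on the cut-off. Dominator repeats his best
  -- move `u` from `S` after `v`, even if it has become illegal. Staller's best move `u` after `v`
  -- is carried back to `S`, as itself when `u` is dominated there.
  movesWithin-mono : ∀ k p {S v} → Dominated S v → movesWithin k p (v ∷ S) ≤ movesWithin k p S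

  -- Playing an illegal `v` amounts to skipping the turn. The optimal legal move `u` costs one move
  -- and, by monotonicity, leaves Staller no longer a play than she would have from `S`.
  dominator-≤-any : ∀ k {S v} → Dominated S v →
    movesWithin (suc k) dominator S ≤ suc (movesWithin k staller (v ∷ S))

  movesWithin-mono zero p d = z≤n
  movesWithin-mono (suc k) dominator {S} {v} d with attained k dominator S
  ... | inj₁ (_ , over)  = ≤-reflexive (absorb (suc k) dominator d (over v))
  ... | inj₂ (u , l , e) = begin
    movesWithin (suc k) dominator (v ∷ S)        ≤⟨ dominator-≤-any k (there (legal⇒dominated d l)) ⟩
    suc (movesWithin k staller (u ∷ v ∷ S))      ≡⟨ cong suc (swap k staller u v) ⟩
    suc (movesWithin k staller (v ∷ u ∷ S))      ≤⟨ s≤s (movesWithin-mono k staller (there d)) ⟩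
    suc (movesWithin k staller (u ∷ S))          ≡⟨ e ⟨
    movesWithin (suc k) dominator S              ∎
    where open ≤-Reasoning
  movesWithin-mono (suc k) staller {S} {v} d with attained k staller (v ∷ S)
  ... | inj₁ (e , _) = ≤-trans (≤-reflexive e) z≤n
  ... | inj₂ (u , l@(_ , w , w∈Nu , w∉vS) , e) with dominated? S u | legal⇒dominated (there d) l
  ...   | yes du | _ = begin
    movesWithin (suc k) staller (v ∷ S)          ≡⟨ e ⟩
    suc (movesWithin k dominator (u ∷ v ∷ S))    ≡⟨ cong suc (swap k dominator u v) ⟩
    suc (movesWithin k dominator (v ∷ u ∷ S))    ≤⟨ s≤s (movesWithin-mono k dominator (there d)) ⟩
    suc (movesWithin k dominator (u ∷ S))        ≤⟨ staller-≥ k (legal du (w , w∈Nu , w∉vS ∘ there)) ⟩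
    movesWithin (suc k) staller S                ∎
    where open ≤-Reasoning
  ...   | no ¬du | there du = contradiction du ¬du
  -- Here u is a new vertex of N[v], so Staller can play v instead.
  ...   | no ¬du | here u∈Nv = begin
    movesWithin (suc k) staller (v ∷ S)          ≡⟨ e ⟩
    suc (movesWithin k dominator (u ∷ v ∷ S))    ≤⟨ s≤s (movesWithin-mono k dominator (here u∈Nv)) ⟩
    suc (movesWithin k dominator (v ∷ S))        ≤⟨ staller-≥ k (legal d (u , u∈Nv , ¬du)) ⟩
    movesWithin (suc k) staller S                ∎
    where open ≤-Reasoning

  dominator-≤-any k {S} {v} d with legal? S v
  ... | yes l = dominator-≤ k l
  ... | no ¬l with attained k dominator S
  ...   | inj₁ (e , _)     = ≤-trans (≤-reflexive e) z≤n
  ...   | inj₂ (u , l , e) = begin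
    movesWithin (suc k) dominator S        ≡⟨ e ⟩
    suc (movesWithin k staller (u ∷ S))    ≤⟨ s≤s (movesWithin-mono k staller (legal⇒dominated d l)) ⟩
    suc (movesWithin k staller S)          ≡⟨ cong suc (absorb k staller d ¬l) ⟨
    suc (movesWithin k staller (v ∷ S))    ∎
    where open ≤-Reasoning

-- Independence of the cut-off, and the first move.

module Cutoff (G : Graph) where
  open Graph G hiding (order)
  open Play G

  -- `us` lists at least the undominated vertices and each legal move dominates one of them. Hence
  -- `k` moves exhaust the play and `j` further ones change nothing.
  movesWithin-stable : ∀ k j p {S} us → (∀ {w} → ¬ Dominated S w → w ∈ us) → length us ≤ k →
    movesWithin (k + j) p S ≡ movesWithin k p S
  movesWithin-stable zero j p [] undominated _ =
    movesWithin-over j p λ _ (_ , _ , _ , w∉S) → contradiction (undominated w∉S) λ ()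
  movesWithin-stable (suc k) j p {S} us undominated us≤ = matched-≡ G G (k + j) k p
    (λ v l → v , l , continue l) (λ v l → v , l , sym (continue l))
    where
    continue : ∀ {v} → Legal S v →
      movesWithin (k + j) (opponent p) (v ∷ S) ≡ movesWithin k (opponent p) (v ∷ S)
    continue {v} (_ , w , w∈Nv , w∉S) = movesWithin-stable k j (opponent p)
      (filter undominated? us)
      (λ x∉vS → ∈-filter⁺ undominated? (undominated (x∉vS ∘ there)) x∉vS)
      (s≤s⁻¹ (≤-trans (filter-notAll undominated? us (lose (undominated w∉S) λ w∉vS → w∉vS (here w∈Nv))) us≤))
      where undominated? = λ x → ¬? (dominated? (v ∷ S) x)

  -- Allows the games on `G`, `H` and `G [ H ]` to be compared at one common cut-off.
  γcg′-within : ∀ {k} → order G ≤ k → γcg′ G ≡ movesWithin k staller []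
  γcg′-within {k} n≤k = begin
    movesWithin (order G) staller []                    ≡⟨ stable ⟨
    movesWithin (order G + (k ∸ order G)) staller []    ≡⟨ cong (λ m → movesWithin m staller []) (m+[n∸m]≡n n≤k) ⟩
    movesWithin k staller []                            ∎
    where
    open ≡-Reasoning
    stable = movesWithin-stable (order G) (k ∸ order G) staller vertices
      (λ {w} _ → ∈-vertices w) (≤-reflexive length-vertices)

  γcg′-≥ : ∀ {k} → order G ≤ suc k → ∀ v → suc (movesWithin k dominator (v ∷ [])) ≤ γcg′ G
  γcg′-≥ {k} n≤k v = ≤-trans (staller-≥ k (legal-[] v)) (≤-reflexive (sym (γcg′-within n≤k)))

  γcg′-attained : ∀ {k} → order G ≤ suc k → ∃ λ v → γcg′ G ≡ suc (movesWithin k dominator (v ∷ []))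
  γcg′-attained {k} n≤k with attained k staller []
  ... | inj₁ (_ , over)  = contradiction (legal-[] someVertex) (over _)
  ... | inj₂ (v , _ , e) = v , trans (γcg′-within n≤k) e

  -- Staller maximises, so the value 1 bounds the play after every first move, not only after an
  -- optimal one.
  reply≡0 : ∀ {k} → order G ≤ suc k → γcg′ G ≡ 1 → ∀ v → movesWithin k dominator (v ∷ []) ≡ 0
  reply≡0 n≤k γ≡1 v = n≤0⇒n≡0 (s≤s⁻¹ (≤-trans (γcg′-≥ n≤k v) (≤-reflexive γ≡1)))

  γcg′≤order : γcg′ G ≤ order G
  γcg′≤order = movesWithin-≤ (order G) staller
    where
    movesWithin-≤ : ∀ k p {S} → movesWithin k p S ≤ k
    movesWithin-≤ zero    p = z≤n
    movesWithin-≤ (suc k) p {S} with attained k p S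
    ... | inj₁ (e , _)     = ≤-trans (≤-reflexive e) z≤n
    ... | inj₂ (_ , _ , e) = ≤-trans (≤-reflexive e) (s≤s (movesWithin-≤ k (opponent p)))

-- Vertex counts and connectedness.

module _ (G : Graph) where
  open Graph G hiding (order)
  open Play G

  -- Index 1 serves the vertex at index 0, and index 0 serves every other. `go` generalises the
  -- order and the index so that both can be matched on.
  order≥2⇒distinct : order G ≥ 2 → ∀ v → ∃ λ u → v ≢ u
  order≥2⇒distinct n≥2 v = go (order G) n≥2 (Inverse.to finite v) (Inverse.from finite)
      (Inverse.strictlyInverseˡ finite) refl
    where
    go : ∀ n → n ≥ 2 → (i : Fin n) (f : Fin n → V) {g : V → Fin n} →
         (∀ j → g (f j) ≡ j) → g v ≡ i → ∃ λ u → v ≢ u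
    go _ (s≤s (s≤s z≤n)) zero    f g∘f e = f (suc zero) , λ { refl → contradiction (trans (sym e) (g∘f (suc zero))) λ () }
    go _ (s≤s (s≤s z≤n)) (suc i) f g∘f e = f zero , λ { refl → contradiction (trans (sym e) (g∘f zero)) λ () }

  order≡1⇒unique : order G ≡ 1 → ∀ u v → u ≡ v
  order≡1⇒unique n≡1 u v = trans (sym (Inverse.strictlyInverseʳ finite u))
    (trans (cong (Inverse.from finite) (go n≡1 _ _)) (Inverse.strictlyInverseʳ finite v))
    where
    go : ∀ {n} → n ≡ 1 → (i j : Fin n) → i ≡ j
    go refl zero zero = refl

  connected⇒neighbour : Connected G → order G ≥ 2 → ∀ v → ∃ λ u → Adj v u
  connected⇒neighbour conn n≥2 v with order≥2⇒distinct n≥2 v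
  ... | u , v≢u with conn v u
  ...   | ε     = contradiction refl v≢u
  ...   | a ◅ _ = _ , a

  -- Domination spreads along a path from `s`: if `u` is dominated and its neighbour `x` is not,
  -- then `u` is a legal move.
  over⇒dominated : Connected G → ∀ {s S} → (∀ v → ¬ Legal (s ∷ S) v) → ∀ v → Dominated (s ∷ S) v
  over⇒dominated conn {s} {S} over v = along (here (inj₁ refl)) (conn s v)
    where
    along : ∀ {u v} → Dominated (s ∷ S) u → Star Adj u v → Dominated (s ∷ S) v
    along d ε = d
    along {u} d (_◅_ {j = x} a as) with dominated? (s ∷ S) x
    ... | yes dx = along dx as
    ... | no ¬dx = contradiction (legal d (x , inj₂ a , ¬dx)) (over u)

  -- The cut-off is a successor because at cut-off 0 the value is 0 in every position.
  over-dominator : ∀ {k S} → movesWithin (suc k) dominator S ≡ 0 → ∀ v → ¬ Legal S v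
  over-dominator {k} {S} e with attained k dominator S
  ... | inj₁ (_ , over)   = over
  ... | inj₂ (_ , _ , e′) = contradiction (trans (sym e′) e) λ ()

-- Fibres of the lexicographic product, and leaving the first one.

module Lexicographic (G H : Graph) where
  private
    module G = Graph G
    module H = Graph H
    module PG = Monotonicity G
    module PH = Monotonicity H
    module PX = Monotonicity (G [ H ])

  h₀ : H.V
  h₀ = PH.someVertex

  g₀ : G.V
  g₀ = PG.someVertex

  ∈N-proj₁ : ∀ {u x} → x PX.∈N[ u ] → proj₁ x PG.∈N[ proj₁ u ]
  ∈N-proj₁ (inj₁ refl)              = inj₁ refl
  ∈N-proj₁ (inj₂ (inj₁ a))          = inj₂ a
  ∈N-proj₁ (inj₂ (inj₂ (refl , _))) = inj₁ refl

  -- Covers several moves, since Dominator may answer in the first fibre before Staller leaves it.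
  InFibre : G.V → PX.Position → Set
  InFibre g = All (λ x → proj₁ x ≡ g)

  fibre-dominated : ∀ {g T x} → InFibre g T → PX.Dominated T x → proj₁ x PG.∈N[ g ]
  fibre-dominated (refl ∷ _) (here e)  = ∈N-proj₁ e
  fibre-dominated (_ ∷ fs)   (there d) = fibre-dominated fs d

  -- Each of two adjacent fibres is dominated entirely by a vertex selected in the other. Moves in
  -- the fibre of `g` dominate nothing outside the fibres over the closed neighbourhood of `g`, so
  -- `T` contributes nothing more.
  dominated-adjacent-fibres : ∀ {g g′ h′ t T} → G.Adj g g′ → InFibre g (t ∷ T) →
    PX.Dominated ((g′ , h′) ∷ t ∷ T) ≐ PG.Dominated (g′ ∷ g ∷ []) ∘ proj₁
  dominated-adjacent-fibres {g} {g′} {h′} {t} {T} a fs@(refl ∷ _) = to , from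
    where
    to : ∀ {x} → PX.Dominated ((g′ , h′) ∷ t ∷ T) x → PG.Dominated (g′ ∷ g ∷ []) (proj₁ x)
    to (here e)  = here (∈N-proj₁ e)
    to (there d) = there (here (fibre-dominated fs d))

    from : ∀ {x} → PG.Dominated (g′ ∷ g ∷ []) (proj₁ x) → PX.Dominated ((g′ , h′) ∷ t ∷ T) x
    from (here (inj₁ refl))         = there (here (inj₂ (inj₁ a)))
    from (here (inj₂ b))            = here (inj₂ (inj₁ b))
    from (there (here (inj₁ refl))) = here (inj₂ (inj₁ (G.adj-sym a)))
    from (there (here (inj₂ b)))    = there (here (inj₂ (inj₁ b)))

  leave-fibre : ∀ k p {g g′ h′ t T} → G.Adj g g′ → InFibre g (t ∷ T) →
    PX.movesWithin k p ((g′ , h′) ∷ t ∷ T) ≡ PG.movesWithin k p (g′ ∷ g ∷ [])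
  leave-fibre k p a fs =
    Projection.lift (G [ H ]) G proj₁ (_, h₀) (λ _ → refl) inj₁ (∈N-proj₁ ∘ inj₂) k p
      (dominated-adjacent-fibres a fs)

  legal⇒adj : ∀ {g u} → PG.Legal (g ∷ []) u → G.Adj g u
  legal⇒adj (inj₂ (here a) , _) = G.adj-sym a

  -- The whole fibre over `w` is still undominated. The witness takes the coordinate `h′` so that it
  -- also works when `w` is `u` itself.
  legal-leave-fibre : ∀ {g u h′ t T} → InFibre g (t ∷ T) → PG.Legal (g ∷ []) u →
    PX.Legal (t ∷ T) (u , h′)
  legal-leave-fibre {h′ = h′} fs@(refl ∷ _) (inj₂ (here a) , w , w∈Nu , w∉g) =
    inj₂ (here (inj₁ a)) , (w , h′) , w∈Nuh w∈Nu , λ d → w∉g (here (fibre-dominated fs d))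
    where
    w∈Nuh : ∀ {u} → w PG.∈N[ u ] → (w , h′) PX.∈N[ (u , h′) ]
    w∈Nuh (inj₁ refl) = inj₁ refl
    w∈Nuh (inj₂ b)    = inj₂ (inj₁ b)

  -- Dominator's reply to the first move.

  reply-≤-adj : ∀ k {g g′} h → G.Adj g g′ →
    PX.movesWithin (suc k) dominator ((g , h) ∷ []) ≤ suc (PG.movesWithin k staller (g′ ∷ g ∷ []))
  reply-≤-adj k {g} {g′} h a = begin
    -- The move into the fibre of `g′` may dominate nothing new, hence `dominator-≤-any`.
    PX.movesWithin (suc k) dominator ((g , h) ∷ [])               ≤⟨ PX.dominator-≤-any k {v = g′ , h} (here (inj₂ (inj₁ a))) ⟩
    suc (PX.movesWithin k staller ((g′ , h) ∷ (g , h) ∷ []))      ≡⟨ cong suc (leave-fibre k staller a (refl ∷ [])) ⟩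
    suc (PG.movesWithin k staller (g′ ∷ g ∷ []))                  ∎
    where open ≤-Reasoning

  -- The `1 ⊔` is for a `g` after which the play on `G` is over, while part of its fibre may remain
  -- undominated. Moving to any neighbouring fibre then ends the play.
  reply-≤ : Connected G → order G ≥ 2 → ∀ k g h →
    PX.movesWithin (suc k) dominator ((g , h) ∷ []) ≤ 1 ⊔ PG.movesWithin (suc k) dominator (g ∷ [])
  reply-≤ conn n≥2 k g h with PG.attained k dominator (g ∷ [])
  ... | inj₂ (g′ , l , e) = begin
    PX.movesWithin (suc k) dominator ((g , h) ∷ [])      ≤⟨ reply-≤-adj k h (legal⇒adj l) ⟩
    suc (PG.movesWithin k staller (g′ ∷ g ∷ []))         ≡⟨ e ⟨
    PG.movesWithin (suc k) dominator (g ∷ [])            ≤⟨ m≤n⊔m 1 (PG.movesWithin (suc k) dominator (g ∷ [])) ⟩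
    1 ⊔ PG.movesWithin (suc k) dominator (g ∷ [])        ∎
    where open ≤-Reasoning
  ... | inj₁ (_ , over) with connected⇒neighbour G conn n≥2 g
  ...   | g′ , a = begin
    PX.movesWithin (suc k) dominator ((g , h) ∷ [])      ≤⟨ reply-≤-adj k h a ⟩
    suc (PG.movesWithin k staller (g′ ∷ g ∷ []))         ≤⟨ s≤s (PG.movesWithin-mono k staller (here (inj₂ a))) ⟩
    suc (PG.movesWithin k staller (g ∷ []))              ≡⟨ cong suc (PG.movesWithin-over k staller over) ⟩
    1                                                    ≤⟨ m≤m⊔n 1 (PG.movesWithin (suc k) dominator (g ∷ [])) ⟩
    1 ⊔ PG.movesWithin (suc k) dominator (g ∷ [])        ∎
    where open ≤-Reasoning

  -- Staller copies her best move `u` on `G` into the fibre over `u`; by `leave-fibre` the rest of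
  -- both plays has the same value.
  staller-fibre-≥ : ∀ k {g t T} → InFibre g (t ∷ T) →
    PG.movesWithin k staller (g ∷ []) ≤ PX.movesWithin k staller (t ∷ T)
  staller-fibre-≥ zero _ = z≤n
  staller-fibre-≥ (suc k) {g} {t} {T} fs with PG.attained k staller (g ∷ [])
  ... | inj₁ (e , _)     = ≤-trans (≤-reflexive e) z≤n
  ... | inj₂ (u , l , e) = begin
    PG.movesWithin (suc k) staller (g ∷ [])                   ≡⟨ e ⟩
    suc (PG.movesWithin k dominator (u ∷ g ∷ []))             ≡⟨ cong suc (leave-fibre k dominator (legal⇒adj l) fs) ⟨
    suc (PX.movesWithin k dominator ((u , h₀) ∷ t ∷ T))       ≤⟨ PX.staller-≥ k (legal-leave-fibre fs l) ⟩
    PX.movesWithin (suc k) staller (t ∷ T)                    ∎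
    where open ≤-Reasoning

  -- If Dominator stays in the first fibre, he has in effect skipped a turn on G.
  reply-≥ : ∀ k g h →
    PG.movesWithin (suc k) dominator (g ∷ []) ≤ PX.movesWithin (suc k) dominator ((g , h) ∷ [])
  reply-≥ k g h with PX.attained k dominator ((g , h) ∷ [])
  ... | inj₁ (_ , over) = ≤-trans
    (≤-reflexive (PG.movesWithin-over (suc k) dominator λ u l → over (u , h₀) (legal-leave-fibre (refl ∷ []) l))) z≤n
  ... | inj₂ ((g′ , h′) , (inj₂ (here (inj₁ a)) , _) , e) = begin
    PG.movesWithin (suc k) dominator (g ∷ [])                     ≤⟨ PG.dominator-≤-any k (here (inj₂ (G.adj-sym a))) ⟩
    suc (PG.movesWithin k staller (g′ ∷ g ∷ []))                  ≡⟨ cong suc (leave-fibre k staller (G.adj-sym a) (refl ∷ [])) ⟨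
    suc (PX.movesWithin k staller ((g′ , h′) ∷ (g , h) ∷ []))     ≡⟨ e ⟨
    PX.movesWithin (suc k) dominator ((g , h) ∷ [])               ∎
    where open ≤-Reasoning
  ... | inj₂ ((g′ , h′) , (inj₂ (here (inj₂ (refl , _))) , _) , e) = begin
    PG.movesWithin (suc k) dominator (g ∷ [])                     ≤⟨ PG.dominator-≤-any k {v = g} (here (inj₁ refl)) ⟩
    suc (PG.movesWithin k staller (g ∷ g ∷ []))                   ≤⟨ s≤s (PG.movesWithin-mono k staller (here (inj₁ refl))) ⟩
    suc (PG.movesWithin k staller (g ∷ []))                       ≤⟨ s≤s (staller-fibre-≥ k (refl ∷ refl ∷ [])) ⟩
    suc (PX.movesWithin k staller ((g , h′) ∷ (g , h) ∷ []))      ≡⟨ e ⟨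
    PX.movesWithin (suc k) dominator ((g , h) ∷ [])               ∎
    where open ≤-Reasoning

  -- Play within a single fibre.

  -- A graph `G` with one vertex has no edges, so the second projection identifies `G [ H ]` with
  -- `H`.
  unique-fibre : (∀ g g′ → g ≡ g′) → ∀ k g h →
    PX.movesWithin k dominator ((g , h) ∷ []) ≡ PH.movesWithin k dominator (h ∷ [])
  unique-fibre unique k g h = Projection.lift (G [ H ]) H proj₂ (g₀ ,_) (λ _ → refl)
    (λ {u} {x} a → inj₂ (unique (proj₁ u) (proj₁ x) , a)) adj⁻ k dominator (to , from)
    where
    adj⁻ : ∀ {u x} → Graph.Adj (G [ H ]) u x → proj₂ x PH.∈N[ proj₂ u ]
    adj⁻ (inj₁ a)       = contradiction a (G.adj-irrefl (unique _ _))
    adj⁻ (inj₂ (_ , a)) = inj₂ a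

    to : ∀ {x} → PX.Dominated ((g , h) ∷ []) x → PH.Dominated (h ∷ []) (proj₂ x)
    to (here (inj₁ refl)) = here (inj₁ refl)
    to (here (inj₂ a))    = here (adj⁻ a)

    from : ∀ {x} → PH.Dominated (h ∷ []) (proj₂ x) → PX.Dominated ((g , h) ∷ []) x
    from {g′ , _} (here (inj₁ refl)) = here (inj₁ (cong (_, h) (unique g′ g)))
    from {g′ , _} (here (inj₂ a))    = here (inj₂ (inj₂ (unique g g′ , a)))

  -- `G.Adj` is irreflexive, so inside its own fibre `(g , h)` dominates exactly what `h` dominates
  -- in `H`.
  legal-in-fibre : ∀ {g h h′} → PH.Legal (h ∷ []) h′ → PX.Legal ((g , h) ∷ []) (g , h′)
  legal-in-fibre {g} {h} {h′} (inj₂ (here a) , w , w∈Nh′ , w∉Nh) =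
    inj₂ (here (inj₂ (refl , a))) , (g , w) , to w∈Nh′ , λ { (here e) → w∉Nh (here (from e)) }
    where
    to : w PH.∈N[ h′ ] → (g , w) PX.∈N[ (g , h′) ]
    to (inj₁ refl) = inj₁ refl
    to (inj₂ b)    = inj₂ (inj₂ (refl , b))

    from : (g , w) PX.∈N[ (g , h) ] → w PH.∈N[ h ]
    from (inj₁ refl)           = inj₁ refl
    from (inj₂ (inj₁ b))       = contradiction b (G.adj-irrefl refl)
    from (inj₂ (inj₂ (_ , b))) = inj₂ b

  dominating-fibre : ∀ {g h} → (∀ x → PG.Dominated (g ∷ []) x) → (∀ y → PH.Dominated (h ∷ []) y) →
    ∀ z → PX.Dominated ((g , h) ∷ []) z
  dominating-fibre dg dh (x , y) with dg x
  ... | here (inj₂ a)    = here (inj₂ (inj₁ a))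
  ... | here (inj₁ refl) with dh y
  ...   | here (inj₁ refl) = here (inj₁ refl)
  ...   | here (inj₂ a)    = here (inj₂ (inj₂ (refl , a)))

  -- Bounds on the value for the product.

  private
    -- The cut-off `suc (suc k)` is at least all three orders, and its two successors let Staller's
    -- first move and Dominator's reply be unfolded.
    k = order (G [ H ])
    module CG = Cutoff G
    module CH = Cutoff H
    module CX = Cutoff (G [ H ])

    G≤k : order G ≤ suc (suc k)
    G≤k = m≤n⇒m≤1+n (m≤n⇒m≤1+n (m≤m*n (order G) (order H) {{H.nonempty}}))

    H≤k : order H ≤ suc (suc k)
    H≤k = m≤n⇒m≤1+n (m≤n⇒m≤1+n (m≤n*m (order H) (order G) {{G.nonempty}}))

    X≤k : order (G [ H ]) ≤ suc (suc k)
    X≤k = m≤n⇒m≤1+n (n≤1+n k)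

  -- The `2` counts Staller's first move and the single finishing move allowed by `reply-≤`.
  γcg′-lexicographic-≤ : Connected G → order G ≥ 2 → γcg′ (G [ H ]) ≤ 2 ⊔ γcg′ G
  γcg′-lexicographic-≤ conn n≥2 with CX.γcg′-attained X≤k
  ... | (g , h) , e = begin
    γcg′ (G [ H ])                                                ≡⟨ e ⟩
    suc (PX.movesWithin (suc k) dominator ((g , h) ∷ []))         ≤⟨ s≤s (reply-≤ conn n≥2 k g h) ⟩
    2 ⊔ suc (PG.movesWithin (suc k) dominator (g ∷ []))           ≤⟨ ⊔-monoʳ-≤ 2 (CG.γcg′-≥ G≤k g) ⟩
    2 ⊔ γcg′ G                                                    ∎
    where open ≤-Reasoning

  γcg′-lexicographic-≥ : γcg′ G ≤ γcg′ (G [ H ])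
  γcg′-lexicographic-≥ with CG.γcg′-attained G≤k
  ... | g , e = begin
    γcg′ G                                                        ≡⟨ e ⟩
    suc (PG.movesWithin (suc k) dominator (g ∷ []))               ≤⟨ s≤s (reply-≥ k g h₀) ⟩
    suc (PX.movesWithin (suc k) dominator ((g , h₀) ∷ []))        ≤⟨ CX.γcg′-≥ X≤k (g , h₀) ⟩
    γcg′ (G [ H ])                                                ∎
    where open ≤-Reasoning

  -- Staller opens at an optimal `h` in some fibre. The play on `H` is not over, and a legal move
  -- there is legal inside the fibre, so a second move exists.
  γcg′-lexicographic-≥2 : γcg′ H ≥ 2 → γcg′ (G [ H ]) ≥ 2
  γcg′-lexicographic-≥2 γ≥2 with CH.γcg′-attained H≤k
  ... | h , e with PH.attained k dominator (h ∷ [])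
  ...   | inj₁ (e′ , _) = contradiction (≤-trans γ≥2 (≤-reflexive (trans e (cong suc e′)))) λ { (s≤s ()) }
  ...   | inj₂ (h′ , l , _) with PX.attained k dominator ((g₀ , h) ∷ [])
  ...     | inj₁ (_ , over)   = contradiction (legal-in-fibre l) (over _)
  ...     | inj₂ (_ , _ , e″) = ≤-trans (s≤s (≤-trans (s≤s z≤n) (≤-reflexive (sym e″)))) (CX.γcg′-≥ X≤k (g₀ , h))

  γcg′-lexicographic-single : order G ≡ 1 → γcg′ (G [ H ]) ≡ γcg′ H
  γcg′-lexicographic-single n≡1 = ≤-antisym ≤H ≥H
    where
    same = unique-fibre (order≡1⇒unique G n≡1) (suc k)

    ≤H : γcg′ (G [ H ]) ≤ γcg′ H
    ≤H with CX.γcg′-attained X≤k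
    ... | (g , h) , e = ≤-trans (≤-reflexive (trans e (cong suc (same g h)))) (CH.γcg′-≥ H≤k h)

    ≥H : γcg′ H ≤ γcg′ (G [ H ])
    ≥H with CH.γcg′-attained H≤k
    ... | h , e = ≤-trans (≤-reflexive (trans e (cong suc (sym (same g₀ h))))) (CX.γcg′-≥ X≤k (g₀ , h))

  -- Every vertex of `G` and of `H` dominates its graph, so whichever `(g , h)` Staller selects
  -- dominates the product.
  γcg′-lexicographic-complete : Connected G → Connected H → γcg′ G ≡ 1 → γcg′ H ≡ 1 → γcg′ (G [ H ]) ≡ 1
  γcg′-lexicographic-complete connG connH γG≡1 γH≡1 with CX.γcg′-attained X≤k
  ... | (g , h) , e = trans e (cong suc (PX.movesWithin-over (suc k) dominator over))
    where
    dominatedG = over⇒dominated G connG (over-dominator G {k} (CG.reply≡0 G≤k γG≡1 g))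
    dominatedH = over⇒dominated H connH (over-dominator H {k} (CH.reply≡0 H≤k γH≡1 h))

    over : ∀ z → ¬ PX.Legal ((g , h) ∷ []) z
    over z (_ , w , _ , w∉) = w∉ (dominating-fibre dominatedG dominatedH w)

theorem4p6 : (G H : Graph) → Connected G →
    (γcg′ G ≥ 2 → γcg′ (G [ H ]) ≡ γcg′ G)
    × (Connected H → γcg′ G ≡ 1 × order G ≥ 2 × γcg′ H ≥ 2 → γcg′ (G [ H ]) ≡ 2)
    × (Connected H → order G ≡ 1 ⊎ (γcg′ G ≡ 1 × order G ≥ 2 × γcg′ H ≡ 1) → γcg′ (G [ H ]) ≡ γcg′ H)
theorem4p6 G H connG =
    (λ γG≥2 → ≤-antisym
      -- A play of two moves needs two vertices, which gives the order bound for Dominator's escape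
      -- to another fibre.
      (≤-trans (γcg′-lexicographic-≤ connG (≤-trans γG≥2 (Cutoff.γcg′≤order G))) (≤-reflexive (m≤n⇒m⊔n≡n γG≥2)))
      γcg′-lexicographic-≥)
  , (λ _ (γG≡1 , n≥2 , γH≥2) → ≤-antisym
      (≤-trans (γcg′-lexicographic-≤ connG n≥2) (≤-reflexive (cong (2 ⊔_) γG≡1)))
      (γcg′-lexicographic-≥2 γH≥2))
  , λ { connH (inj₁ n≡1) → γcg′-lexicographic-single n≡1
      ; connH (inj₂ (γG≡1 , _ , γH≡1)) →
          trans (γcg′-lexicographic-complete connG connH γG≡1 γH≡1) (sym γH≡1) }
  where open Lexicographic G H
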